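{- For every integer $n\ge0$, $B_{3,1}(n)=T(n)$. Here $B_{3,1}(n)$ is the number of partitions $\pi=(\pi_1\ge\pi_2\ge\dots\ge\pi_\ell)$ of $n$ such that $m_1(\pi)=0$, $m_j(\pi)+m_{j+1}(\pi)\le 2$ for all $j\ge1$, and for every $1\le j<\ell$, if $\pi_j-\pi_{j+1}\le1$ then $\pi_j+\pi_{j+1}\equiv 0\pmod 2$. And $T(n)$ is the number of partitions $\lambda$ of $n$ such that: $m_j(\lambda)\le 1$ for odd $j$; $m_j(\lambda)=0$ for odd $j<R_1(\lambda)+2$; $m_j(\lambda)\ge2$ for even $j$ with $0<j<R_1(\lambda)$; and no two consecutive integers both appear as parts of $\lambda$.
   Context: $m_j(\pi)$ is the multiplicity of $j$ as a part of $\pi$. $R_1(\lambda)$ is the largest part of $\lambda$ with multiplicity at least $2$, or $0$ if there is none. -}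

module Defs where

open import Data.List.Base using (List; []; _∷_; _++_; map; filter; length)
open import Data.List.Extrema.Nat using (max; xs≤max)
open import Data.List.Membership.Propositional using (_∈_)
open import Data.List.Membership.Propositional.Properties
  using (∈-map⁺; ∈-map⁻; ∈-++⁺ˡ; ∈-++⁺ʳ; ∈-filter⁺; ∈-filter⁻)
open import Data.List.Properties using (filter-none; ∷-injectiveʳ)
open import Data.List.Relation.Unary.All as All using (All; []; _∷_)
import Data.List.Relation.Unary.All.Properties as All
open import Data.List.Relation.Unary.AllPairs using ([]; _∷_)
open import Data.List.Relation.Unary.Any using (here)
open import Data.List.Relation.Unary.Linked using (Linked; linked?)
open import Data.List.Relation.Unary.Unique.Propositional using (Unique)
import Data.List.Relation.Unary.Unique.Propositional.Properties as Unique
open import Data.Nat.Base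
open import Data.Nat.Divisibility using (_∣_; _∤_; _∣?_)
open import Data.Nat.ListAction using (sum)
open import Data.Nat.Properties
open import Data.List.Membership.DecPropositional _≟_ using (_∈?_)
open import Data.Product.Base using (_×_; _,_; proj₂)
open import Function.Base using (_∘_)
open import Function.Bundles using (_⇔_; mk⇔)
open import Relation.Binary.PropositionalEquality
open import Relation.Nullary using (¬_; Dec; yes; no)
open import Relation.Nullary.Decidable using (map′; _×-dec_; _→-dec_; ¬?)
open import Level using (0ℓ)
open import Relation.Unary using (Pred; Decidable)

record IsPartition (n : ℕ) (π : List ℕ) : Set where
  field
    positive      : All (0 <_) π
    nonincreasing : Linked _≥_ π
    sum≡n         : sum π ≡ n

isPartition? : ∀ n → Decidable (IsPartition n)
isPartition? n π =
  map′ (λ (p , q , r) → record { positive = p ; nonincreasing = q ; sum≡n = r })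
       (λ P → let open IsPartition P in positive , nonincreasing , sum≡n)
       (All.all? (0 <?_) π ×-dec linked? _≥?_ π ×-dec (sum π ≟ n))

incHead : List ℕ → List ℕ
incHead []       = []
incHead (k ∷ ks) = suc k ∷ ks

-- Compositions serve only as a structurally recursive list of candidates.
compositions : ℕ → List (List ℕ)
compositions 0               = [] ∷ []
compositions 1               = (1 ∷ []) ∷ []
compositions (suc n@(suc _)) =
  map (1 ∷_) (compositions n) ++ map incHead (compositions n)

partitions : ℕ → List (List ℕ)
partitions n = filter (isPartition? n) (compositions n)

numberOfPartitions : {P : Pred (List ℕ) 0ℓ} → Decidable P → ℕ → ℕ
numberOfPartitions P? n = length (filter P? (partitions n))

private
  incHead⁺ : ∀ {ks} → All (0 <_) ks → All (0 <_) (incHead ks)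
  incHead⁺ []       = []
  incHead⁺ (_ ∷ ps) = z<s ∷ ps

  incHead-injective : ∀ {xs ys} → incHead xs ≡ incHead ys → xs ≡ ys
  incHead-injective {[]}    {[]}    _    = refl
  incHead-injective {_ ∷ _} {_ ∷ _} refl = refl

  compositions-positive : ∀ n → All (All (0 <_)) (compositions n)
  compositions-positive 0 = [] ∷ []
  compositions-positive 1 = (z<s ∷ []) ∷ []
  compositions-positive (suc n@(suc _)) =
    All.++⁺ (All.map⁺ (All.map (z<s ∷_) (compositions-positive n)))
            (All.map⁺ (All.map incHead⁺ (compositions-positive n)))

  compositions-complete : ∀ n {π} → All (0 <_) π → sum π ≡ n → π ∈ compositions n
  compositions-complete 0 [] _ = here refl
  compositions-complete 0 {suc _ ∷ _} _ ()
  compositions-complete 1 {0 ∷ _} (() ∷ _) _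
  compositions-complete 1 {1 ∷ []} _ _ = here refl
  compositions-complete 1 {1 ∷ 0 ∷ _} (_ ∷ () ∷ _) _
  compositions-complete (suc n@(suc _)) {1 ∷ _} (_ ∷ ps) eq =
    ∈-++⁺ˡ (∈-map⁺ (1 ∷_) (compositions-complete n ps (suc-injective eq)))
  compositions-complete (suc n@(suc _)) {suc (suc _) ∷ _} (_ ∷ ps) eq =
    ∈-++⁺ʳ (map (1 ∷_) (compositions n))
      (∈-map⁺ incHead (compositions-complete n (z<s ∷ ps) (suc-injective eq)))

  compositions-unique : ∀ n → Unique (compositions n)
  compositions-unique 0 = [] ∷ []
  compositions-unique 1 = [] ∷ []
  compositions-unique (suc n@(suc _)) =
    Unique.++⁺ (Unique.map⁺ ∷-injectiveʳ (compositions-unique n))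
               (Unique.map⁺ incHead-injective (compositions-unique n))
               disjoint
    where
    disjoint : ∀ {π} → ¬ (π ∈ map (1 ∷_) (compositions n) × π ∈ map incHead (compositions n))
    disjoint (p , q) with ∈-map⁻ (1 ∷_) p | ∈-map⁻ incHead q
    ... | _ , _ , refl | 0 ∷ _ , r , _ with () ∷ _ ← All.lookup (compositions-positive n) r

∈-partitions : ∀ {n π} → π ∈ partitions n ⇔ IsPartition n π
∈-partitions {n} = mk⇔
  (proj₂ ∘ ∈-filter⁻ (isPartition? n) {xs = compositions n})
  (λ P → let open IsPartition P in
    ∈-filter⁺ (isPartition? n) (compositions-complete n positive sum≡n) P)

partitions-unique : ∀ n → Unique (partitions n)
partitions-unique n = Unique.filter⁺ (isPartition? n) (compositions-unique n)

mult : ℕ → List ℕ → ℕ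
mult j π = length (filter (_≟ j) π)

R₁ : List ℕ → ℕ
R₁ π = max 0 (filter (λ j → 2 ≤? mult j π) π)

mult≡0 : ∀ {j} π → max 0 π < j → mult j π ≡ 0
mult≡0 π max<j = cong length
  (filter-none (_≟ _) (All.map (λ x≤max → <⇒≢ (≤-<-trans x≤max max<j)) (xs≤max 0 π)))

private
  all<? : ∀ {P : Pred ℕ 0ℓ} → Decidable P → ∀ b → Dec (∀ j → j < b → P j)
  all<? P? b = map′ (λ f j → f {j}) (λ f {j} → f j) (allUpTo? P? b)

  allFrom? : ∀ {P : Pred ℕ 0ℓ} → Decidable P →
             ∀ b → (∀ j → b ≤ j → P j) → Dec (∀ j → P j)
  allFrom? {P} P? b large = map′ to (λ f j _ → f j) (all<? P? b)
    where
    to : (∀ j → j < b → P j) → ∀ j → P j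
    to small j with j <? b
    ... | yes j<b = small j j<b
    ... | no  j≮b = large j (≮⇒≥ j≮b)

record IsB₃₁ (π : List ℕ) : Set where
  field
    no-ones    : mult 1 π ≡ 0
    mult-bound : ∀ j → 1 ≤ j → mult j π + mult (suc j) π ≤ 2
    -- On a nonincreasing list the truncated subtraction is exact.
    close-even : Linked (λ a b → a ∸ b ≤ 1 → 2 ∣ a + b) π

record IsT (π : List ℕ) : Set where
  field
    odd-distinct   : ∀ j → 2 ∤ j → mult j π ≤ 1
    odd-large      : ∀ j → 2 ∤ j → j < R₁ π + 2 → mult j π ≡ 0
    even-repeated  : ∀ j → 2 ∣ j → 0 < j → j < R₁ π → 2 ≤ mult j π
    no-consecutive : ∀ j → ¬ (j ∈ π × suc j ∈ π)

isB₃₁? : Decidable IsB₃₁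
isB₃₁? π =
  map′ (λ (p , q , r) → record { no-ones = p ; mult-bound = q ; close-even = r })
       (λ P → let open IsB₃₁ P in no-ones , mult-bound , close-even)
       ( (mult 1 π ≟ 0)
  ×-dec allFrom? (λ j → (1 ≤? j) →-dec (mult j π + mult (suc j) π ≤? 2))
                 (suc (max 0 π)) large
  ×-dec linked? (λ a b → (a ∸ b ≤? 1) →-dec (2 ∣? a + b)) π)
  where
  large : ∀ j → max 0 π < j → 1 ≤ j → mult j π + mult (suc j) π ≤ 2
  large j max<j _ rewrite mult≡0 π max<j | mult≡0 π (m<n⇒m<1+n max<j) = z≤n

isT? : Decidable IsT
isT? π =
  map′ (λ (p , q , r , s) → record
         { odd-distinct   = p
         ; odd-large      = λ j odd j< → q j j< odd
         ; even-repeated  = λ j even 0<j j< → r j j< even 0<j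
         ; no-consecutive = λ j (j∈ , 1+j∈) → All.lookup s j∈ 1+j∈
         })
       (λ P → let open IsT P in
           odd-distinct
         , (λ j j< odd → odd-large j odd j<)
         , (λ j j< even 0<j → even-repeated j even 0<j j<)
         , All.tabulate (λ {j} j∈ 1+j∈ → no-consecutive j (j∈ , 1+j∈)))
       ( allFrom? (λ j → ¬? (2 ∣? j) →-dec (mult j π ≤? 1)) (suc (max 0 π))
                  (λ j max<j _ → ≤-trans (≤-reflexive (mult≡0 π max<j)) z≤n)
  ×-dec all<? (λ j → ¬? (2 ∣? j) →-dec (mult j π ≟ 0)) (R₁ π + 2)
  ×-dec all<? (λ j → (2 ∣? j) →-dec ((0 <? j) →-dec (2 ≤? mult j π))) (R₁ π)
  ×-dec All.all? (λ j → ¬? (suc j ∈? π)) π)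

B₃₁ : ℕ → ℕ
B₃₁ = numberOfPartitions isB₃₁?

T : ℕ → ℕ
T = numberOfPartitions isT?

{-# OPTIONS --safe #-}

-- A partition counted by B₃,₁ is a sequence of distinct values, pairwise non-adjacent and at least 2,
-- each occurring once or twice. Listing from the smallest value the excess of each step over 2 turns
-- it into a word in letters single k and double k. A partition counted by T with R₁ = 2r consists of
-- r even values, each repeated at least twice, and of distinct non-adjacent parts above 2r, so it is
-- coded by two sequences of naturals. Merging these two sequences as in the theory of P-partitions
-- (repeatedly subtract the smaller head from the larger) gives all the words, and it preserves the
-- size. On generating functions this is the recurrence
--   (1 - q^(m+2r)) F(m,r) = q^(2m+4r) (F(m-1,r) + F(m,r-1)),
-- solved by F(m,r) = q^((m+r)²+r²+m+2r) / ((q;q)_m (q²;q²)_r).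
module Submission where

open import Defs
open import Data.List.Base
  using (List; []; _∷_; _++_; _∷ʳ_; length; map; filter; foldl; foldr; replicate)
open import Data.List.Extrema.Nat using (xs≤max; max≤v⁺)
open import Data.List.Membership.Propositional using (_∈_; _∉_)
open import Data.List.Membership.Propositional.Properties using (∈-filter⁺; ∈-filter⁻)
open import Data.List.Properties
  using (∷-injective; ∷-injectiveˡ; ∷-injectiveʳ; filter-accept; filter-reject; filter-none;
         foldl-∷ʳ; foldl-map; length-removeAt′)
open import Data.List.Relation.Unary.All as All using (All; []; _∷_)
open import Data.List.Relation.Unary.AllPairs using ([]; _∷_)
open import Data.List.Relation.Unary.Any using (here; there; index; _─_)
open import Data.List.Relation.Unary.Linked as Linked using (Linked; []; [-]; _∷_)
open import Data.List.Relation.Unary.Linked.Properties using (Linked⇒All)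
open import Data.List.Relation.Unary.Unique.Propositional using (Unique)
import Data.List.Relation.Unary.Unique.Propositional.Properties as Unique
open import Data.List.Reverse using (Reverse; []; _∶_∶ʳ_; reverseView)
open import Data.Nat.Base
open import Data.Nat.Divisibility using (_∣_; _∤_; divides; n∣m*n)
open import Data.Nat.ListAction using (sum)
open import Data.Nat.Properties
open import Data.Nat.Tactic.RingSolver using (solve-∀)
open import Data.Product.Base using (_×_; _,_; proj₁; proj₂; ∃)
open import Data.Product.Properties using (,-injective)
open import Data.Sum.Base using (_⊎_; inj₁; inj₂)
open import Function.Base using (_∘_)
open import Function.Bundles using (module Equivalence)
open import Relation.Binary.PropositionalEquality
open import Relation.Nullary using (¬_; Dec; yes; no; contradiction)

-- Counting along an injective relation, and injectivity of left folds.

module _ {A B : Set} (R : A → B → Set) (R-injective : ∀ {x y z} → R x z → R y z → x ≡ y) where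

  private
    ∈-─ : ∀ {y z : B} {ys} (y∈ : y ∈ ys) → z ∈ ys → z ≢ y → z ∈ (ys ─ y∈)
    ∈-─ (here refl) (here refl) z≢y = contradiction refl z≢y
    ∈-─ (here refl) (there z∈)  _   = z∈
    ∈-─ (there _)   (here refl) _   = here refl
    ∈-─ (there y∈)  (there z∈)  z≢y = there (∈-─ y∈ z∈ z≢y)

  -- Pigeonhole: pair the head of `xs` with some `y` and delete `y` from `ys`. Since `R` is
  -- injective, no other entry of `xs` is related to `y`, so the partners of the rest survive the
  -- deletion.
  length-≤ : ∀ {xs ys} → Unique xs → All (λ x → ∃ λ y → y ∈ ys × R x y) xs → length xs ≤ length ys
  length-≤ [] [] = z≤n
  length-≤ {x ∷ xs} {ys} (x∉ ∷ uniq) ((y , y∈ , xRy) ∷ related) =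
    ≤-trans (s≤s (length-≤ uniq (All.zipWith step (x∉ , related))))
            (≤-reflexive (sym (length-removeAt′ ys (index y∈))))
    where
    step : ∀ {x′} → x ≢ x′ × (∃ λ z → z ∈ ys × R x′ z) → ∃ λ z → z ∈ (ys ─ y∈) × R x′ z
    step (x≢x′ , z , z∈ , x′Rz) =
      z , ∈-─ y∈ z∈ (λ { refl → x≢x′ (R-injective xRy x′Rz) }) , x′Rz

-- The last letter is applied outermost, so letters are peeled off from the right. No step returns a
-- start value, hence the two words run out together. The start values may differ because `toT`
-- folds from `evens bs`.
foldl-injective : {A B : Set} (f : B → A → B) →
  (∀ {b b′ a a′} → f b a ≡ f b′ a′ → b ≡ b′ × a ≡ a′) →
  ∀ {e e′} → (∀ b a → f b a ≢ e) → (∀ b a → f b a ≢ e′) →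
  ∀ xs ys → foldl f e xs ≡ foldl f e′ ys → e ≡ e′ × xs ≡ ys
foldl-injective f inj {e} {e′} f≢e f≢e′ xs ys = go (reverseView xs) (reverseView ys)
  where
  go : ∀ {xs ys} → Reverse xs → Reverse ys → foldl f e xs ≡ foldl f e′ ys → e ≡ e′ × xs ≡ ys
  go [] [] eq = eq , refl
  go [] (ys ∶ _ ∶ʳ y) eq = contradiction (sym (trans eq (foldl-∷ʳ f e′ y ys))) (f≢e _ y)
  go (xs ∶ _ ∶ʳ x) [] eq = contradiction (trans (sym (foldl-∷ʳ f e x xs)) eq) (f≢e′ _ x)
  go (xs ∶ rs ∶ʳ x) (ys ∶ ss ∶ʳ y) eq
    with eq₁ , refl ← inj (trans (sym (foldl-∷ʳ f e x xs)) (trans eq (foldl-∷ʳ f e′ y ys)))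
    with eq₂ , refl ← go rs ss eq₁ = eq₂ , refl

-- Multiplicities, `R₁` and parity.

mult-here : ∀ x l → mult x (x ∷ l) ≡ suc (mult x l)
mult-here x l = cong length (filter-accept (_≟ x) refl)

mult-there : ∀ {j x} l → x ≢ j → mult j (x ∷ l) ≡ mult j l
mult-there {j} l x≢j = cong length (filter-reject (_≟ j) x≢j)

mult-replicate-here : ∀ w x l → mult x (replicate w x ++ l) ≡ w + mult x l
mult-replicate-here zero    x l = refl
mult-replicate-here (suc w) x l =
  trans (mult-here x (replicate w x ++ l)) (cong suc (mult-replicate-here w x l))

mult-replicate-there : ∀ {j x} w l → x ≢ j → mult j (replicate w x ++ l) ≡ mult j l
mult-replicate-there zero    l x≢j = refl
mult-replicate-there (suc w) l x≢j =
  trans (mult-there (replicate w _ ++ l) x≢j) (mult-replicate-there w l x≢j)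

mult-∷ : ∀ j x l → mult j l ≤ mult j (x ∷ l)
mult-∷ j x l with x ≟ j
... | yes refl rewrite mult-here x l = n≤1+n _
... | no  x≢j  rewrite mult-there l x≢j = ≤-refl

mult-∉ : ∀ {j} l → All (_≢ j) l → mult j l ≡ 0
mult-∉ {j} l l≢j = cong length (filter-none (_≟ j) l≢j)

mult-beyond : ∀ {j t l} → All (_≤ t) l → t < j → mult j l ≡ 0
mult-beyond {l = l} l≤t t<j = mult-∉ l (All.map (λ x≤t → <⇒≢ (≤-<-trans x≤t t<j)) l≤t)

mult>0⇒∈ : ∀ {j} l → 0 < mult j l → j ∈ l
mult>0⇒∈ {j} (x ∷ l) 0<m with x ≟ j
... | yes refl = here refl
... | no  x≢j  rewrite mult-there l x≢j = there (mult>0⇒∈ l 0<m)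

∈⇒mult>0 : ∀ {j l} → j ∈ l → 0 < mult j l
∈⇒mult>0 {j} {l = _ ∷ l} (here refl) rewrite mult-here j l = z<s
∈⇒mult>0 {j} {l = x ∷ l} (there j∈)  = ≤-trans (∈⇒mult>0 j∈) (mult-∷ j x l)

repeated⇒≤R₁ : ∀ {i} l → 2 ≤ mult i l → i ≤ R₁ l
repeated⇒≤R₁ l 2≤m = All.lookup (xs≤max 0 _)
  (∈-filter⁺ (λ j → 2 ≤? mult j l) (mult>0⇒∈ l (≤-trans (n≤1+n 1) 2≤m)) 2≤m)

R₁≤ : ∀ {v} l → (∀ {i} → 2 ≤ mult i l → i ≤ v) → R₁ l ≤ v
R₁≤ l bound = max≤v⁺ {xs = filter (λ j → 2 ≤? mult j l) l} z≤n
  (All.tabulate (λ i∈ → bound (proj₂ (∈-filter⁻ (λ j → 2 ≤? mult j l) {xs = l} i∈))))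

2∤1+2n : ∀ n → 2 ∤ suc (n * 2)
2∤1+2n n (divides q eq) = even≢odd q n (trans (*-comm 2 q) (trans (sym eq) (cong suc (*-comm n 2))))

even-suc : ∀ {n} → 2 ∣ n → 2 ∤ suc n
even-suc (divides q refl) = 2∤1+2n q

-- Codes for the partitions counted by `B₃₁`.

top : List ℕ → ℕ
top []      = 0
top (x ∷ _) = x

sorted-≤top : ∀ {l} → Linked _≥_ l → All (_≤ top l) l
sorted-≤top {[]}    _  = []
sorted-≤top {_ ∷ _} L = Linked⇒All (λ p q → ≤-trans q p) ≤-refl L

sorted-∷ : ∀ {x l} → top l ≤ x → Linked _≥_ l → Linked _≥_ (x ∷ l)
sorted-∷ {l = []}    _   _ = [-]
sorted-∷ {l = _ ∷ _} t≤x L = t≤x ∷ L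

-- Because `top []` is 0, the gap of at least 2 also applies to the smallest value, which excludes
-- the part 1.
extend : List ℕ → ℕ → List ℕ
extend l k = 2 + k + top l ∷ l

push : List ℕ → ℕ ⊎ ℕ → List ℕ
push l (inj₁ k) = extend l k
push l (inj₂ k) = 2 + k + top l ∷ extend l k

top<2+ : ∀ k t → t < 2 + k + t
top<2+ k t = s≤s (m≤n+m t (suc k))

extend-injective : ∀ {l l′ k k′} → extend l k ≡ extend l′ k′ → l ≡ l′ × k ≡ k′
extend-injective {l} {k = k} {k′} eq with ∷-injective eq
... | eq₁ , refl = refl , +-cancelʳ-≡ (top l) k k′ (suc-injective (suc-injective eq₁))

-- This tells a single letter from a double one in `push`, and in `toT` the distinct parts from the
-- repeated ones beneath them.
extend-strict : ∀ {l k x l′} → extend l k ≢ x ∷ x ∷ l′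
extend-strict {k = k} {x} eq with eq₁ , refl ← ∷-injective eq = <-irrefl (sym eq₁) (top<2+ k x)

push-injective : ∀ {l l′ a a′} → push l a ≡ push l′ a′ → l ≡ l′ × a ≡ a′
push-injective {a = inj₁ k} {inj₁ k′} eq with refl , refl ← extend-injective {k = k} {k′} eq = refl , refl
push-injective {a = inj₁ k} {inj₂ k′} eq = contradiction eq (extend-strict {k = k})
push-injective {a = inj₂ k} {inj₁ k′} eq = contradiction (sym eq) (extend-strict {k = k′})
push-injective {a = inj₂ k} {inj₂ k′} eq
  with refl , refl ← extend-injective {k = k} {k′} (∷-injectiveʳ eq) = refl , refl

push≢[] : ∀ l a → push l a ≢ []
push≢[] l (inj₁ _) ()
push≢[] l (inj₂ _) ()

-- inj₁ k and inj₂ k add a value 2 + k above the previous one, once and twice respectively;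
-- smallest value first.
Code : Set
Code = List (ℕ ⊎ ℕ)

toB : Code → List ℕ
toB = foldl push []

toB-injective : ∀ {c d} → toB c ≡ toB d → c ≡ d
toB-injective {c} {d} eq = proj₂ (foldl-injective push push-injective push≢[] push≢[] c d eq)

-- The image of `toB`, with the letter of the largest value outermost: that is the end from which a
-- nonincreasing list is taken apart, while codes start at the smallest value.
data BShape : List ℕ → Set where
  []      : BShape []
  _+push_ : ∀ {l} → BShape l → ∀ a → BShape (push l a)

toB-shape : ∀ c → BShape (toB c)
toB-shape = go []
  where
  go : ∀ {l} → BShape l → ∀ c → BShape (foldl push l c)
  go s []      = s
  go s (a ∷ c) = go (s +push a) c

shape-toB : ∀ {l} → BShape l → ∃ λ c → toB c ≡ l
shape-toB [] = [] , refl
shape-toB (s +push a) with c , refl ← shape-toB s = c ∷ʳ a , foldl-∷ʳ push [] a c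

≰∸1 : ∀ k t → ¬ (2 + k + t ∸ t ≤ 1)
≰∸1 k t p with s≤s () ← subst (_≤ 1) (m+n∸n≡m (2 + k) t) p

Close : ℕ → ℕ → Set
Close a b = a ∸ b ≤ 1 → 2 ∣ a + b

2∣n+n : ∀ n → 2 ∣ n + n
2∣n+n n = divides n (solve n)
  where
  solve : ∀ n → n + n ≡ n * 2
  solve = solve-∀

shape-sorted : ∀ {l} → BShape l → Linked _≥_ l
shape-sorted [] = []
shape-sorted (_+push_ {l} s (inj₁ k)) = sorted-∷ (<⇒≤ (top<2+ k (top l))) (shape-sorted s)
shape-sorted (_+push_ {l} s (inj₂ k)) = ≤-refl ∷ sorted-∷ (<⇒≤ (top<2+ k (top l))) (shape-sorted s)

shape-≥2 : ∀ {l} → BShape l → All (2 ≤_) l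
shape-≥2 [] = []
shape-≥2 (s +push inj₁ k) = s≤s (s≤s z≤n) ∷ shape-≥2 s
shape-≥2 (s +push inj₂ k) = s≤s (s≤s z≤n) ∷ s≤s (s≤s z≤n) ∷ shape-≥2 s

extend-close : ∀ l k → Linked Close l → Linked Close (extend l k)
extend-close []      k _ = [-]
extend-close (t ∷ _) k L = (λ p → contradiction p (≰∸1 k t)) ∷ L

shape-close : ∀ {l} → BShape l → Linked Close l
shape-close [] = []
shape-close (_+push_ {l} s (inj₁ k)) = extend-close l k (shape-close s)
shape-close (_+push_ {l} s (inj₂ k)) = (λ _ → 2∣n+n (2 + k + top l)) ∷ extend-close l k (shape-close s)

-- As `x` is at least 2 above all of `l`, none of `x - 1`, `x` and `x + 1` occurs in `l`. A pair of
-- consecutive values involving `x` therefore counts only the `w` new copies.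
replicate-mult : ∀ {w x t l} → w ≤ 2 → All (_≤ t) l → 2 + t ≤ x →
                 (∀ j → mult j l + mult (suc j) l ≤ 2) →
                 ∀ j → mult j (replicate w x ++ l) + mult (suc j) (replicate w x ++ l) ≤ 2
replicate-mult {w} {x} {l = l} w≤2 l≤t t<x bound j with x ≟ j | x ≟ suc j
... | yes refl | _ = ≤-trans (≤-reflexive (cong₂ _+_
  (trans (mult-replicate-here w x l) (cong (w +_) (mult-beyond l≤t (<⇒≤ t<x))))
  (trans (mult-replicate-there w l (1+n≢n ∘ sym)) (mult-beyond l≤t (m<n⇒m<1+n (<⇒≤ t<x))))))
  (≤-trans (≤-reflexive (trans (+-identityʳ (w + 0)) (+-identityʳ w))) w≤2)
... | no x≢j | yes refl = ≤-trans (≤-reflexive (cong₂ _+_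
  (trans (mult-replicate-there w l x≢j) (mult-beyond l≤t (s≤s⁻¹ t<x)))
  (trans (mult-replicate-here w x l) (cong (w +_) (mult-beyond l≤t (<⇒≤ t<x))))))
  (≤-trans (≤-reflexive (+-identityʳ w)) w≤2)
... | no x≢j | no x≢1+j = ≤-trans (≤-reflexive (cong₂ _+_
  (mult-replicate-there w l x≢j) (mult-replicate-there w l x≢1+j))) (bound j)

shape-mult : ∀ {l} → BShape l → ∀ j → mult j l + mult (suc j) l ≤ 2
shape-mult [] j = z≤n
shape-mult (_+push_ {l} s (inj₁ k)) =
  replicate-mult {1} (n≤1+n 1) (sorted-≤top (shape-sorted s)) (s≤s (s≤s (m≤n+m (top l) k))) (shape-mult s)
shape-mult (_+push_ {l} s (inj₂ k)) =
  replicate-mult {2} ≤-refl (sorted-≤top (shape-sorted s)) (s≤s (s≤s (m≤n+m (top l) k))) (shape-mult s)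

shape⇒IsB₃₁ : ∀ {l} → BShape l → IsB₃₁ l
shape⇒IsB₃₁ {l} s = record
  { no-ones    = mult-∉ l (All.map (λ { (s≤s ()) refl }) (shape-≥2 s))
  ; mult-bound = λ j _ → shape-mult s j
  ; close-even = shape-close s
  }

≥2+⇒extend : ∀ {x} l → 2 + top l ≤ x → ∃ λ k → x ≡ 2 + k + top l
≥2+⇒extend l p = _ , trans (sym (m∸n+n≡m p)) (trans (+-suc _ _) (cong suc (+-suc _ _)))

IsB₃₁⇒shape : ∀ l → All (0 <_) l → Linked _≥_ l → IsB₃₁ l → BShape l
IsB₃₁⇒shape [] _ _ _ = []
IsB₃₁⇒shape (x ∷ []) (0<x ∷ _) _ b
  with k , refl ← ≥2+⇒extend {x} [] (≤∧≢⇒< 0<x λ { refl → 1+n≢0 (IsB₃₁.no-ones b) }) = [] +push inj₁ k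
-- Shapes of both tails are prepared in advance: a single letter removes one entry, a double letter
-- two.
IsB₃₁⇒shape (x ∷ y ∷ l) (0<x ∷ 0<) (x≥y ∷ L) b = go (x ≟ y)
  (IsB₃₁⇒shape (y ∷ l) 0< L (tail b)) (IsB₃₁⇒shape l (All.tail 0<) (Linked.tail L) (tail (tail b)))
  where
  tail : ∀ {x l} → IsB₃₁ (x ∷ l) → IsB₃₁ l
  tail {x} {l} b = record
    { no-ones    = n≤0⇒n≡0 (≤-trans (mult-∷ 1 x l) (≤-reflexive b.no-ones))
    ; mult-bound = λ j 1≤j →
        ≤-trans (+-mono-≤ (mult-∷ j x l) (mult-∷ (suc j) x l)) (b.mult-bound j 1≤j)
    ; close-even = Linked.tail b.close-even
    }
    where module b = IsB₃₁ b
  -- A difference of exactly 1 would make the sum of the neighbours odd.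
  step : ∀ {x y} → x ≥ y → x ≢ y → Close x y → 2 + y ≤ x
  step {x} {y} x≥y x≢y close = ≤∧≢⇒< (≤∧≢⇒< x≥y (x≢y ∘ sym)) λ { refl →
    2∤1+2n y (subst (2 ∣_) (cong suc (trans (cong (y +_) (sym (+-identityʳ y))) (*-comm 2 y)))
      (close (≤-reflexive (m+n∸n≡m 1 y)))) }
  below : ∀ {x l} → 0 < x → Linked _≥_ (x ∷ l) → IsB₃₁ (x ∷ x ∷ l) → 2 + top l ≤ x
  below {l = []} 0<x _ b = ≤∧≢⇒< 0<x λ { refl → 1+n≢0 (IsB₃₁.no-ones b) }
  below {x} {z ∷ l} 0<x (x≥z ∷ _) b = step x≥z x≢z (Linked.head (IsB₃₁.close-even (tail b)))
    where
    -- A third copy of `x` would violate `mult-bound` at `j = x`.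
    x≢z : x ≢ z
    x≢z refl with IsB₃₁.mult-bound b x 0<x
    ... | p rewrite mult-here x (x ∷ x ∷ l) | mult-here x (x ∷ l) | mult-here x l
      with s≤s (s≤s ()) ← p
  go : Dec (x ≡ y) → BShape (y ∷ l) → BShape l → BShape (x ∷ y ∷ l)
  go (no x≢y) s _
    with k , refl ← ≥2+⇒extend (y ∷ l) (step x≥y x≢y (Linked.head (IsB₃₁.close-even b))) =
    s +push inj₁ k
  go (yes refl) _ s with k , refl ← ≥2+⇒extend l (below 0<x L b) = s +push inj₂ k

-- Pairs of sequences for the partitions counted by `T`.

data Stack : ℕ → List ℕ → Set where
  []   : Stack 0 []
  new  : ∀ {r l} → Stack r l → Stack (suc r) (suc r * 2 ∷ suc r * 2 ∷ l)
  more : ∀ {r l} → Stack (suc r) l → Stack (suc r) (suc r * 2 ∷ l)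

-- Here `r * 2` is `R₁ l`: the stack holds 2, 4, ..., `r * 2`, each at least twice, and the
-- extensions are the parts of multiplicity 1 above it.
data TShape (r : ℕ) : List ℕ → Set where
  base      : ∀ {l} → Stack r l → TShape r l
  _+extend_ : ∀ {l} → TShape r l → ∀ k → TShape r (extend l k)

-- Multiplicities in excess of 2, largest even number first.
evens : List ℕ → List ℕ
evens []       = []
evens (b ∷ bs) = replicate (2 + b) (suc (length bs) * 2) ++ evens bs

toT : List ℕ × List ℕ → List ℕ
toT (as , bs) = foldl extend (evens bs) as

evens-stack : ∀ bs → Stack (length bs) (evens bs)
evens-stack [] = []
evens-stack (b ∷ bs) = go b
  where
  go : ∀ b → Stack (suc (length bs)) (evens (b ∷ bs))
  go zero    = new (evens-stack bs)
  go (suc b) = more (go b)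

stack-evens : ∀ {r l} → Stack r l → ∃ λ bs → length bs ≡ r × evens bs ≡ l
stack-evens [] = [] , refl , refl
stack-evens (new s) with bs , refl , refl ← stack-evens s = 0 ∷ bs , refl , refl
stack-evens (more s) with b ∷ bs , refl , refl ← stack-evens s = suc b ∷ bs , refl , refl

toT-shape : ∀ p → TShape (length (proj₂ p)) (toT p)
toT-shape (as , bs) = go (base (evens-stack bs)) as
  where
  go : ∀ {r l} → TShape r l → ∀ as → TShape r (foldl extend l as)
  go s []       = s
  go s (a ∷ as) = go (s +extend a) as

shape-toT : ∀ {r l} → TShape r l → ∃ λ p → toT p ≡ l
shape-toT (base s) with bs , _ , refl ← stack-evens s = ([] , bs) , refl
shape-toT (s +extend k) with (as , bs) , refl ← shape-toT s =
  (as ∷ʳ k , bs) , foldl-∷ʳ extend (evens bs) k as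

top-stack : ∀ {r l} → Stack r l → top l ≡ r * 2
top-stack []       = refl
top-stack (new _)  = refl
top-stack (more _) = refl

evens-injective : ∀ bs bs′ → evens bs ≡ evens bs′ → bs ≡ bs′
evens-injective [] [] _ = refl
evens-injective (b ∷ bs) (b′ ∷ bs′) eq = go b b′ eq
  where
  -- If the largest value had different multiplicities, cancelling copies would equate `evens bs`,
  -- whose top is `length bs * 2`, with a list headed by the next even number.
  below : ∀ bs {x l} → x ≡ suc (length bs) * 2 → evens bs ≢ x ∷ l
  below bs refl eq =
    <-irrefl (trans (sym (top-stack (evens-stack bs))) (cong top eq)) (m≤n+m _ 1)
  go : ∀ b b′ → evens (b ∷ bs) ≡ evens (b′ ∷ bs′) → b ∷ bs ≡ b′ ∷ bs′
  go zero zero eq = cong (0 ∷_) (evens-injective bs bs′ (∷-injectiveʳ (∷-injectiveʳ eq)))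
  go zero (suc b′) eq = contradiction (∷-injectiveʳ (∷-injectiveʳ eq))
    (below bs (sym (∷-injectiveˡ eq)))
  go (suc b) zero eq = contradiction (sym (∷-injectiveʳ (∷-injectiveʳ eq)))
    (below bs′ (∷-injectiveˡ eq))
  go (suc b) (suc b′) eq with refl ← go b b′ (∷-injectiveʳ eq) = refl

extend≢evens : ∀ bs l k → extend l k ≢ evens bs
extend≢evens [] l k ()
extend≢evens (b ∷ bs) l k = extend-strict {l} {k}

toT-injective : ∀ {p q} → toT p ≡ toT q → p ≡ q
toT-injective {as , bs} {as′ , bs′} eq
  with eq₁ , refl ← foldl-injective extend extend-injective (extend≢evens bs) (extend≢evens bs′) as as′ eq
  with refl ← evens-injective bs bs′ eq₁ = refl

stack-even : ∀ {r l} → Stack r l → All (2 ∣_) l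
stack-even []       = []
stack-even {suc r} (new s)  = n∣m*n (suc r) ∷ n∣m*n (suc r) ∷ stack-even s
stack-even {suc r} (more s) = n∣m*n (suc r) ∷ stack-even s

stack-sorted : ∀ {r l} → Stack r l → Linked _≥_ l
stack-sorted []       = []
stack-sorted (new s)  =
  ≤-refl ∷ sorted-∷ (≤-trans (≤-reflexive (top-stack s)) (m≤n+m _ 2)) (stack-sorted s)
stack-sorted (more s) = sorted-∷ (≤-reflexive (top-stack s)) (stack-sorted s)

stack-≥2 : ∀ {r l} → Stack r l → All (2 ≤_) l
stack-≥2 []       = []
stack-≥2 (new s)  = s≤s (s≤s z≤n) ∷ s≤s (s≤s z≤n) ∷ stack-≥2 s
stack-≥2 (more s) = s≤s (s≤s z≤n) ∷ stack-≥2 s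

stack-mult : ∀ {r l} → Stack r l → ∀ s → 0 < s → s ≤ r → 2 ≤ mult (s * 2) l
stack-mult [] zero () _
stack-mult [] (suc _) _ ()
stack-mult {suc r} {_ ∷ _ ∷ l} (new st) s 0<s s≤r with s ≟ suc r
... | yes refl rewrite mult-here (suc r * 2) (suc r * 2 ∷ l) | mult-here (suc r * 2) l = s≤s (s≤s z≤n)
... | no s≢r = ≤-trans (stack-mult st s 0<s (s≤s⁻¹ (≤∧≢⇒< s≤r s≢r)))
                 (≤-trans (mult-∷ (s * 2) (suc r * 2) l) (mult-∷ (s * 2) (suc r * 2) (suc r * 2 ∷ l)))
stack-mult {suc r} {_ ∷ l} (more st) s 0<s s≤r =
  ≤-trans (stack-mult st s 0<s s≤r) (mult-∷ (s * 2) (suc r * 2) l)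

T-sorted : ∀ {r l} → TShape r l → Linked _≥_ l
T-sorted (base s) = stack-sorted s
T-sorted (_+extend_ {l} s k) = sorted-∷ (<⇒≤ (top<2+ k (top l))) (T-sorted s)

T-≥2 : ∀ {r l} → TShape r l → All (2 ≤_) l
T-≥2 (base s)      = stack-≥2 s
T-≥2 (s +extend k) = s≤s (s≤s z≤n) ∷ T-≥2 s

T-top : ∀ {r l} → TShape r l → r * 2 ≤ top l
T-top (base s) = ≤-reflexive (sym (top-stack s))
T-top (_+extend_ {l} s k) = ≤-trans (T-top s) (<⇒≤ (top<2+ k (top l)))

T-repeated : ∀ {r l i} → TShape r l → 2 ≤ mult i l → i ≤ r * 2
T-repeated {l = l} (base s) 2≤m = ≤-trans
  (All.lookup (sorted-≤top (stack-sorted s)) (mult>0⇒∈ l (<⇒≤ 2≤m)))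
  (≤-reflexive (top-stack s))
T-repeated {i = i} (_+extend_ {l} s k) 2≤m with 2 + k + top l ≟ i
... | no x≢i rewrite mult-there l x≢i = T-repeated s 2≤m
... | yes refl
  rewrite mult-here i l | mult-beyond (sorted-≤top (T-sorted s)) (top<2+ k (top l))
  with s≤s () ← 2≤m

T-even-repeated : ∀ {r l} → TShape r l → ∀ s → 0 < s → s ≤ r → 2 ≤ mult (s * 2) l
T-even-repeated (base st) = stack-mult st
T-even-repeated (_+extend_ {l} st k) s 0<s s≤r =
  ≤-trans (T-even-repeated st s 0<s s≤r) (mult-∷ (s * 2) (2 + k + top l) l)

-- Every extension is at least `r * 2 + 2`, so a smaller part belongs to the stack. Both conditions
-- of `IsT` on odd parts follow from this.
T-low-even : ∀ {r l j} → TShape r l → j ∈ l → j < r * 2 + 2 → 2 ∣ j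
T-low-even (base s) j∈ _ = All.lookup (stack-even s) j∈
T-low-even (s +extend k) (there j∈) j< = T-low-even s j∈ j<
T-low-even {r} (_+extend_ {l} s k) (here refl) j< = contradiction j< (≤⇒≯ (begin
  r * 2 + 2       ≡⟨ +-comm (r * 2) 2 ⟩
  2 + r * 2       ≤⟨ s≤s (s≤s (T-top s)) ⟩
  2 + top l       ≤⟨ s≤s (s≤s (m≤n+m (top l) k)) ⟩
  2 + k + top l   ∎))
  where open ≤-Reasoning

T-no-consecutive : ∀ {r l} → TShape r l → ∀ j → ¬ (j ∈ l × suc j ∈ l)
T-no-consecutive (base s) j (j∈ , 1+j∈) =
  even-suc (All.lookup (stack-even s) j∈) (All.lookup (stack-even s) 1+j∈)
T-no-consecutive (s +extend k) j (there j∈ , there 1+j∈) = T-no-consecutive s j (j∈ , 1+j∈)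
T-no-consecutive (_+extend_ {l} s k) j (there j∈ , here refl) =
  <⇒≱ (s≤s (m≤n+m (top l) k)) (All.lookup (sorted-≤top (T-sorted s)) j∈)
T-no-consecutive (_+extend_ {l} s k) j (here refl , there 1+j∈) =
  <⇒≱ (m<n⇒m<1+n (top<2+ k (top l))) (All.lookup (sorted-≤top (T-sorted s)) 1+j∈)
T-no-consecutive (s +extend k) j (here p , here q) = 1+n≢n (trans q (sym p))

shape⇒IsT : ∀ {r l} → TShape r l → IsT l
shape⇒IsT {r} {l} s = record
  { odd-distinct   = λ j odd → s≤s⁻¹ (≰⇒> λ 2≤m →
      odd (T-low-even s (mult>0⇒∈ l (<⇒≤ 2≤m)) (≤-<-trans (T-repeated s 2≤m) (m<m+n (r * 2) z<s))))
  ; odd-large      = λ j odd j< → n≤0⇒n≡0 (s≤s⁻¹ (≰⇒> λ 0<m →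
      odd (T-low-even s (mult>0⇒∈ l 0<m) (<-≤-trans j< (+-monoˡ-≤ 2 R₁≤2r)))))
  ; even-repeated  = λ { j (divides q refl) 0<j j< →
      T-even-repeated s q (*-cancelʳ-< 2 0 q 0<j) (*-cancelʳ-≤ q r 2 (≤-trans (<⇒≤ j<) R₁≤2r)) }
  ; no-consecutive = T-no-consecutive s
  }
  where
  R₁≤2r : R₁ l ≤ r * 2
  R₁≤2r = R₁≤ l (T-repeated s)

-- Unlike IsT, these consequences of it pass to the tail of a nonincreasing list at once; together
-- they force everything else: odd parts below a repeated part would be next to an even part.
record TCore (l : List ℕ) : Set where
  field
    no-ones        : 1 ∉ l
    odd-distinct   : ∀ j → 2 ∤ j → mult j l ≤ 1
    even-repeated  : ∀ i j → 2 ≤ mult i l → 2 ∣ j → 0 < j → j < i → 2 ≤ mult j l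
    no-consecutive : ∀ j → ¬ (j ∈ l × suc j ∈ l)

IsT⇒TCore : ∀ {l} → IsT l → TCore l
IsT⇒TCore {l} t = record
  -- The bound `R₁ l + 2` exceeds 1 even when nothing is repeated, so `odd-large` applies to the
  -- part 1.
  { no-ones        = λ 1∈ → <-irrefl (sym (t.odd-large 1 (2∤1+2n 0) (m≤n+m 2 (R₁ l)))) (∈⇒mult>0 1∈)
  ; odd-distinct   = t.odd-distinct
  ; even-repeated  = λ i j 2≤m even 0<j j<i →
      t.even-repeated j even 0<j (<-≤-trans j<i (repeated⇒≤R₁ l 2≤m))
  ; no-consecutive = t.no-consecutive
  }
  where module t = IsT t

-- Only `even-repeated` needs an argument: if `i` is repeated in `l`, then `j < i ≤ x`, so dropping
-- `x` leaves the multiplicity of `j` unchanged.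
TCore-tail : ∀ {x l} → Linked _≥_ (x ∷ l) → TCore (x ∷ l) → TCore l
TCore-tail {x} {l} L t = record
  { no-ones        = t.no-ones ∘ there
  ; odd-distinct   = λ j odd → ≤-trans (mult-∷ j x l) (t.odd-distinct j odd)
  ; even-repeated  = λ i j 2≤m even 0<j j<i →
      subst (2 ≤_) (mult-there l (>⇒≢ (<-≤-trans j<i (i≤x i 2≤m))))
        (t.even-repeated i j (≤-trans 2≤m (mult-∷ i x l)) even 0<j j<i)
  ; no-consecutive = λ j (j∈ , 1+j∈) → t.no-consecutive j (there j∈ , there 1+j∈)
  }
  where
  module t = TCore t
  i≤x : ∀ i → 2 ≤ mult i l → i ≤ x
  i≤x i 2≤m = All.lookup (sorted-≤top L) (there (mult>0⇒∈ l (<⇒≤ 2≤m)))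

TCore⇒shape : ∀ l → All (0 <_) l → Linked _≥_ l → TCore l → ∃ λ r → TShape r l
TCore⇒shape [] _ _ _ = 0 , base []
TCore⇒shape (x ∷ []) (0<x ∷ _) _ t
  with k , refl ← ≥2+⇒extend {x} [] (≤∧≢⇒< 0<x (TCore.no-ones t ∘ here)) = 0 , base [] +extend k
TCore⇒shape (x ∷ l@(y ∷ _)) (0<x ∷ 0<) L@(x≥y ∷ L′) t
  with r , s ← TCore⇒shape l 0< L′ (TCore-tail L t) = go (x ≟ y) s
  where
  module t = TCore t
  1+y≢x : suc y ≢ x
  1+y≢x refl = t.no-consecutive y (there (here refl) , here refl)
  go : ∀ {r} → Dec (x ≡ y) → TShape r l → ∃ λ r → TShape r (x ∷ l)
  go (no x≢y) s
    with k , refl ← ≥2+⇒extend l (≤∧≢⇒< (≤∧≢⇒< x≥y (x≢y ∘ sym)) 1+y≢x) = _ , s +extend k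
  go (yes refl) (base (new s))  = _ , base (more (new s))
  go (yes refl) (base (more s)) = _ , base (more (more s))
  -- The recursion took `x` for a part of multiplicity 1, but this is its second copy. Hence `x`
  -- must be the next even number above the stack, and the two copies open a new level.
  go {r} (yes refl) (_+extend_ {l′} s k) = _ , base
    (subst (λ v → Stack (suc r) (v ∷ v ∷ l′)) (sym x≡) (settle s (≤-trans 2+top≤x x≤)))
    where
    2≤m : 2 ≤ mult x (x ∷ l)
    2≤m rewrite mult-here x l | mult-here x l′ = s≤s (s≤s z≤n)
    2+top≤x : 2 + top l′ ≤ x
    2+top≤x = s≤s (s≤s (m≤n+m (top l′) k))
    -- Otherwise `suc r * 2` is a positive even number below the repeated `x`, so it is itself
    -- repeated, already within `l′`, where repetitions stop at `r * 2`.
    x≤ : x ≤ suc r * 2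
    x≤ = ≮⇒≥ λ r<x → <⇒≱ (n<1+n (r * 2)) (≤-trans (n≤1+n _) (T-repeated s (subst (2 ≤_)
      (trans (mult-there l (>⇒≢ r<x)) (mult-there l′ (>⇒≢ r<x)))
      (t.even-repeated x (suc r * 2) 2≤m (n∣m*n (suc r)) z<s r<x))))
    x≡ : x ≡ suc r * 2
    x≡ = ≤-antisym x≤ (≤-trans (s≤s (s≤s (T-top s))) 2+top≤x)
    -- The hypothesis leaves `top l′` at most `r * 2`, and any extension would lift it higher, so
    -- `l′` is the bare stack.
    settle : ∀ {l′} → TShape r l′ → 2 + top l′ ≤ suc r * 2 →
             Stack (suc r) (suc r * 2 ∷ suc r * 2 ∷ l′)
    settle (base s) _ = new s
    settle (_+extend_ {l″} s k′) top≤ = contradiction (T-top s)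
      (<⇒≱ (<-≤-trans (top<2+ k′ (top l″)) (s≤s⁻¹ (s≤s⁻¹ top≤))))

-- Merging two sequences into one code.

-- For `as` this moves all distinct parts up by `k`; for `bs` it adds `k` copies of the largest
-- repeated value.
raise : ℕ → List ℕ → List ℕ
raise k []       = []
raise k (b ∷ bs) = k + b ∷ bs

-- The inverse of place merges the two sequences, comparing their heads.
place : ℕ ⊎ ℕ → List ℕ × List ℕ → List ℕ × List ℕ
place (inj₁ k) (as , bs) = k ∷ as , raise (suc k) bs
place (inj₂ k) (as , bs) = raise k as , k ∷ bs

split : Code → List ℕ × List ℕ
split = foldr place ([] , [])

raise-injective : ∀ k xs ys → raise k xs ≡ raise k ys → xs ≡ ys
raise-injective k []       []       _  = refl
raise-injective k (x ∷ xs) (y ∷ ys) eq with eq₁ , refl ← ∷-injective eq =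
  cong (_∷ xs) (+-cancelˡ-≡ k x y eq₁)

raise-≤ : ∀ {k x l} xs → x ∷ l ≡ raise k xs → k ≤ x
raise-≤ {k} (x ∷ _) refl = m≤m+n k x

-- With an empty sequence read as having an infinite head, `inj₁` makes the first head strictly
-- smaller and `inj₂` makes the second head at most the first. The `suc k` in `place` is what keeps
-- ties out of the first case.
place-disjoint : ∀ {k k′} p q → place (inj₁ k) p ≢ place (inj₂ k′) q
place-disjoint (as , bs) (as′ , bs′) eq with eq₁ , eq₂ ← ,-injective eq =
  <⇒≱ (raise-≤ bs (sym eq₂)) (raise-≤ as′ eq₁)

place-injective : ∀ x y {p q} → place x p ≡ place y q → x ≡ y × p ≡ q
place-injective (inj₁ k) (inj₁ k′) {_ , bs} {_ , bs′} eq
  with refl , eq₂ ← ,-injective eq with refl ← raise-injective (suc k) bs bs′ eq₂ = refl , refl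
place-injective (inj₂ k) (inj₂ k′) {as , _} {as′ , _} eq
  with eq₁ , refl ← ,-injective eq with refl ← raise-injective k as as′ eq₁ = refl , refl
place-injective (inj₁ _) (inj₂ _) {p} {q} eq = contradiction eq (place-disjoint p q)
place-injective (inj₂ _) (inj₁ _) {p} {q} eq = contradiction (sym eq) (place-disjoint q p)

place≢[] : ∀ x p → place x p ≢ ([] , [])
place≢[] (inj₁ _) _ ()
place≢[] (inj₂ _) _ ()

split-injective : ∀ c d → split c ≡ split d → c ≡ d
split-injective []      []      _  = refl
split-injective []      (y ∷ d) eq = contradiction (sym eq) (place≢[] y (split d))
split-injective (x ∷ c) []      eq = contradiction eq (place≢[] x (split c))
split-injective (x ∷ c) (y ∷ d) eq with refl , eq′ ← place-injective x y eq =
  cong (x ∷_) (split-injective c d eq′)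

-- The smaller head becomes a letter and is subtracted from the other. `insert` holds the first head
-- apart from `as`, so that altering it keeps the recursion structural: either `as` gets shorter, or
-- `as` stays and `bs` gets shorter.
split-surjective : ∀ as bs → ∃ λ c → split c ≡ (as , bs)
insert : ∀ a as bs → ∃ λ c → split c ≡ (a ∷ as , bs)

split-surjective []       []       = [] , refl
split-surjective []       (b ∷ bs) with c , eq ← split-surjective [] bs = inj₂ b ∷ c , cong (place (inj₂ b)) eq
split-surjective (a ∷ as) bs       = insert a as bs

insert a as [] with c , eq ← split-surjective as [] = inj₁ a ∷ c , cong (place (inj₁ a)) eq
insert a as (b ∷ bs) with compare a b
... | less .a k with c , eq ← split-surjective as (k ∷ bs) = inj₁ a ∷ c , cong (place (inj₁ a)) eq
-- A tie is read as a double letter and leaves the difference 0 as the first head.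
... | equal .a with c , eq ← insert 0 as bs =
  inj₂ a ∷ c , trans (cong (place (inj₂ a)) eq) (cong (λ x → x ∷ as , a ∷ bs) (+-identityʳ a))
... | greater .b k with c , eq ← insert (suc k) as bs =
  inj₂ b ∷ c , trans (cong (place (inj₂ b)) eq) (cong (λ x → x ∷ as , b ∷ bs) (+-suc b k))

-- Preservation of the sum.

size : Code → ℕ
size []           = 0
size (inj₁ _ ∷ c) = suc (size c)
size (inj₂ _ ∷ c) = 2 + size c

-- A letter lifts the parts it creates and all later ones by `2 + k`; `size` counts these parts.
weight : Code → ℕ
weight []           = 0
weight (inj₁ k ∷ c) = (2 + k) * size (inj₁ k ∷ c) + weight c
weight (inj₂ k ∷ c) = (2 + k) * size (inj₂ k ∷ c) + weight c

-- The middle summand is there because each part still to be pushed stands on the height `top l`.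
sum-pushes : ∀ l c → sum (foldl push l c) ≡ sum l + top l * size c + weight c
sum-pushes l [] = lemma (sum l) (top l)
  where
  lemma : ∀ s t → s ≡ s + t * 0 + 0
  lemma = solve-∀
sum-pushes l (inj₁ k ∷ c) = trans (sum-pushes (push l (inj₁ k)) c) (lemma (sum l) k (top l) (size c) (weight c))
  where
  lemma : ∀ s k t z w → (2 + k + t + s) + (2 + k + t) * z + w ≡ s + t * (1 + z) + ((2 + k) * (1 + z) + w)
  lemma = solve-∀
sum-pushes l (inj₂ k ∷ c) = trans (sum-pushes (push l (inj₂ k)) c) (lemma (sum l) k (top l) (size c) (weight c))
  where
  lemma : ∀ s k t z w → (2 + k + t + (2 + k + t + s)) + (2 + k + t) * z + w ≡
                        s + t * (2 + z) + ((2 + k) * (2 + z) + w)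
  lemma = solve-∀

size-singles : ∀ as → size (map inj₁ as) ≡ length as
size-singles []       = refl
size-singles (_ ∷ as) = cong suc (size-singles as)

-- The middle summand is the height `r * 2` of the stack, contributed once to each distinct part.
pairWeight : List ℕ × List ℕ → ℕ
pairWeight (as , bs) = sum (evens bs) + length bs * 2 * length as + weight (map inj₁ as)

sum-toT : ∀ p → sum (toT p) ≡ pairWeight p
sum-toT (as , bs) = begin
  sum (foldl extend (evens bs) as)                ≡⟨ cong sum (foldl-map push inj₁ (evens bs) as) ⟨
  sum (foldl push (evens bs) (map inj₁ as))       ≡⟨ sum-pushes (evens bs) (map inj₁ as) ⟩
  sum (evens bs) + top (evens bs) * size (map inj₁ as) + weight (map inj₁ as)
    ≡⟨ cong₂ (λ t m → sum (evens bs) + t * m + weight (map inj₁ as))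
             (top-stack (evens-stack bs)) (size-singles as) ⟩
  pairWeight (as , bs)                            ∎
  where open ≡-Reasoning

length-raise : ∀ k xs → length (raise k xs) ≡ length xs
length-raise k []      = refl
length-raise k (_ ∷ _) = refl

sum-replicate-++ : ∀ m x l → sum (replicate m x ++ l) ≡ m * x + sum l
sum-replicate-++ zero    x l = refl
sum-replicate-++ (suc m) x l =
  trans (cong (x +_) (sum-replicate-++ m x l)) (sym (+-assoc x (m * x) (sum l)))

sum-evens-∷ : ∀ b bs → sum (evens (b ∷ bs)) ≡ (2 + b) * (suc (length bs) * 2) + sum (evens bs)
sum-evens-∷ b bs = sum-replicate-++ (2 + b) (suc (length bs) * 2) (evens bs)

sum-evens-raise : ∀ k bs → sum (evens (raise k bs)) ≡ sum (evens bs) + k * (length bs * 2)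
sum-evens-raise k [] = sym (*-zeroʳ k)
sum-evens-raise k (b ∷ bs) = trans (sum-evens-∷ (k + b) bs) (trans
  (lemma k b (suc (length bs) * 2) (sum (evens bs)))
  (cong (_+ k * (suc (length bs) * 2)) (sym (sum-evens-∷ b bs))))
  where
  lemma : ∀ k b x s → (2 + (k + b)) * x + s ≡ (2 + b) * x + s + k * x
  lemma = solve-∀

weight-raise : ∀ k as → weight (map inj₁ (raise k as)) ≡ weight (map inj₁ as) + k * length as
weight-raise k [] = sym (*-zeroʳ k)
weight-raise k (a ∷ as) rewrite size-singles as =
  lemma k a (length as) (weight (map inj₁ as))
  where
  lemma : ∀ k a m w → (2 + (k + a)) * (1 + m) + w ≡ (2 + a) * (1 + m) + w + k * (1 + m)
  lemma = solve-∀

size-split : ∀ c → size c ≡ length (proj₁ (split c)) + length (proj₂ (split c)) * 2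
size-split [] = refl
size-split (inj₁ k ∷ c) rewrite length-raise (suc k) (proj₂ (split c)) = cong suc (size-split c)
size-split (inj₂ k ∷ c) rewrite length-raise k (proj₁ (split c)) =
  trans (cong (2 +_) (size-split c)) (lemma (length (proj₁ (split c))) (length (proj₂ (split c))))
  where
  lemma : ∀ m r → 2 + (m + r * 2) ≡ m + suc r * 2
  lemma = solve-∀

-- Let the rest of the code split into `m` distinct parts and `r` levels. The letter `inj₁ k` weighs
-- `(2 + k) * (1 + m + r * 2)`: the new excess accounts for `(2 + k) * (1 + m)`, the raise for
-- `(1 + k) * (r * 2)`, and the height under one more distinct part for `r * 2`. The letter `inj₂ k`
-- weighs `(2 + k) * (2 + m + r * 2)`: the new level accounts for `(2 + k) * (suc r * 2)`, the raise
-- for `k * m`, and a stack higher by 2 for `2 * m`.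
weight-split : ∀ c → weight c ≡ pairWeight (split c)
weight-split [] = refl
weight-split (inj₁ k ∷ c)
  rewrite length-raise (suc k) (proj₂ (split c)) | sum-evens-raise (suc k) (proj₂ (split c))
        | weight-split c | size-split c | size-singles (proj₁ (split c)) =
  lemma k (length (proj₁ (split c))) (length (proj₂ (split c)))
        (sum (evens (proj₂ (split c)))) (weight (map inj₁ (proj₁ (split c))))
  where
  lemma : ∀ k m r e w → (2 + k) * suc (m + r * 2) + (e + r * 2 * m + w) ≡
                        e + suc k * (r * 2) + r * 2 * suc m + ((2 + k) * suc m + w)
  lemma = solve-∀
weight-split (inj₂ k ∷ c)
  rewrite length-raise k (proj₁ (split c)) | weight-raise k (proj₁ (split c))
        | weight-split c | size-split c = trans
  (lemma k m r (sum (evens (proj₂ (split c)))) w)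
  (cong (λ e → e + suc r * 2 * m + (w + k * m)) (sym (sum-evens-∷ k (proj₂ (split c)))))
  where
  m r w : ℕ
  m = length (proj₁ (split c))
  r = length (proj₂ (split c))
  w = weight (map inj₁ (proj₁ (split c)))
  lemma : ∀ k m r e w → (2 + k) * (2 + (m + r * 2)) + (e + r * 2 * m + w) ≡
                        (2 + k) * (suc r * 2) + e + suc r * 2 * m + (w + k * m)
  lemma = solve-∀

sum-toB≡sum-toT : ∀ c → sum (toB c) ≡ sum (toT (split c))
sum-toB≡sum-toT c =
  trans (sum-pushes [] c) (trans (weight-split c) (sym (sum-toT (split c))))

-- The correspondence between partitions of `n`.

module _ (n : ℕ) where

  Bs Ts : List (List ℕ)
  Bs = filter isB₃₁? (partitions n)
  Ts = filter isT? (partitions n)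

  ∈Bs⁻ : ∀ {l} → l ∈ Bs → IsPartition n l × IsB₃₁ l
  ∈Bs⁻ l∈ with p , b ← ∈-filter⁻ isB₃₁? {xs = partitions n} l∈ = Equivalence.to ∈-partitions p , b

  ∈Ts⁻ : ∀ {l} → l ∈ Ts → IsPartition n l × IsT l
  ∈Ts⁻ l∈ with p , t ← ∈-filter⁻ isT? {xs = partitions n} l∈ = Equivalence.to ∈-partitions p , t

  toB∈Bs : ∀ {c} → sum (toB c) ≡ n → toB c ∈ Bs
  toB∈Bs {c} eq = ∈-filter⁺ isB₃₁? (Equivalence.from ∈-partitions record
    { positive      = All.map <⇒≤ (shape-≥2 (toB-shape c))
    ; nonincreasing = shape-sorted (toB-shape c)
    ; sum≡n         = eq
    }) (shape⇒IsB₃₁ (toB-shape c))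

  toT∈Ts : ∀ {p} → sum (toT p) ≡ n → toT p ∈ Ts
  toT∈Ts {p} eq = ∈-filter⁺ isT? (Equivalence.from ∈-partitions record
    { positive      = All.map <⇒≤ (T-≥2 (toT-shape p))
    ; nonincreasing = T-sorted (toT-shape p)
    ; sum≡n         = eq
    }) (shape⇒IsT (toT-shape p))

  -- A relation through a common code avoids choosing inverse functions; read in either direction it
  -- satisfies the hypotheses of `length-≤`, one inequality each.
  Corresponds : List ℕ → List ℕ → Set
  Corresponds π ƛ = ∃ λ c → toB c ≡ π × toT (split c) ≡ ƛ

  Bs→Ts : ∀ {π} → π ∈ Bs → ∃ λ ƛ → ƛ ∈ Ts × Corresponds π ƛ
  Bs→Ts π∈ with record { positive = 0< ; nonincreasing = L ; sum≡n = eq } , b ← ∈Bs⁻ π∈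
    with c , refl ← shape-toB (IsB₃₁⇒shape _ 0< L b) =
    toT (split c) , toT∈Ts {split c} (trans (sym (sum-toB≡sum-toT c)) eq) , c , refl , refl

  Ts→Bs : ∀ {ƛ} → ƛ ∈ Ts → ∃ λ π → π ∈ Bs × Corresponds π ƛ
  Ts→Bs ƛ∈ with record { positive = 0< ; nonincreasing = L ; sum≡n = eq } , t ← ∈Ts⁻ ƛ∈
    with _ , s ← TCore⇒shape _ 0< L (IsT⇒TCore t)
    with (as , bs) , refl ← shape-toT s
    with c , refl ← split-surjective as bs =
    toB c , toB∈Bs {c} (trans (sum-toB≡sum-toT c) eq) , c , refl , refl

  corresponds-injectiveˡ : ∀ {π π′ ƛ} → Corresponds π ƛ → Corresponds π′ ƛ → π ≡ π′
  corresponds-injectiveˡ (c , refl , refl) (d , refl , eq) =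
    cong toB (split-injective c d (toT-injective {split c} {split d} (sym eq)))

  corresponds-injectiveʳ : ∀ {π ƛ ƛ′} → Corresponds π ƛ → Corresponds π ƛ′ → ƛ ≡ ƛ′
  corresponds-injectiveʳ (c , refl , refl) (d , eq , refl) =
    cong (toT ∘ split) (toB-injective {c} {d} (sym eq))

theorem8 : (n : ℕ) → B₃₁ n ≡ T n
theorem8 n = ≤-antisym
  (length-≤ (Corresponds n) (corresponds-injectiveˡ n)
    (Unique.filter⁺ isB₃₁? (partitions-unique n)) (All.tabulate (Bs→Ts n)))
  (length-≤ (λ ƛ π → Corresponds n π ƛ) (corresponds-injectiveʳ n)
    (Unique.filter⁺ isT? (partitions-unique n)) (All.tabulate (Ts→Bs n)))
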